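{- Suppose that $n$ is a strongly pseudoperfect number of the form $n=2^k p$, where $k$ is a nonnegative integer, $p=2^m-1$ for some positive integer $m$, and $p$ is prime. Then $n$ is perfect, i.e. $\sigma(n)=2n$.
   Context: $\sigma(n)$ denotes the sum of the positive divisors of $n$. A positive integer $n$ is strongly pseudoperfect if there is a subset $S$ of the positive divisors of $n$ (with $1$ and $n$ themselves allowed) such that $d\in S$ if and only if $n/d\in S$ for every positive divisor $d$ of $n$, and $\sum_{d\in S} d = 2n$. -}

module Defs where

open import Data.List.Base using (List; filter; map; upTo)
open import Data.List.Membership.Propositional using (_∈_)
open import Data.List.Relation.Unary.All using (All)
open import Data.List.Relation.Unary.Unique.Propositional using (Unique)
open import Data.Nat.Base using (ℕ; suc; _*_; NonZero)
open import Data.Nat.Divisibility using (_∣_; _∣?_; quotient)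
open import Data.Nat.ListAction using (sum)
open import Data.Product.Base using (_×_; ∃-syntax)
open import Function.Bundles using (_⇔_)
open import Relation.Binary.PropositionalEquality.Core using (_≡_)

-- The candidates 1, …, n exhaust the positive divisors of n when n is
-- positive; for n = 0 the list is empty.
divisors : ℕ → List ℕ
divisors n = filter (_∣? n) (map suc (upTo n))

σ : ℕ → ℕ
σ n = sum (divisors n)

Perfect : ℕ → Set
Perfect n = NonZero n × σ n ≡ 2 * n

-- A finite set is a duplicate-free list, so that `sum S` counts each
-- element once.  Since n is nonzero, every d dividing n is positive and
-- `quotient d∣n` is n / d.
StronglyPseudoperfect : ℕ → Set
StronglyPseudoperfect n =
  NonZero n ×
  ∃[ S ] (Unique S
        × All (_∣ n) S
        × (∀ {d} (d∣n : d ∣ n) → d ∈ S ⇔ quotient d∣n ∈ S)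
        × sum S ≡ 2 * n)

-- Let M = 2 ^ m = p + 1.  For i ≤ k the digit dᵢ is 1 if 2 ^ i, equivalently its
-- cofactor 2 ^ (k ∸ i) * p, is missing from S, and 0 otherwise.  The missing
-- divisors sum to Y + X p with Y = Σ dᵢ 2 ^ i and X = Σ dᵢ 2 ^ (k ∸ i), so X
-- and Y are bit reversals of each other, and σ(n) − 2n = Y + X p becomes
-- Y + (X + 1) p + 1 = 2 ^ (k + 1).  Write 2 ^ (k + 1) = M T.  By bit reversal,
-- X < T iff M ∣ Y, and Y < T iff M ∣ X; by the equation, M ∣ X iff M ∣ Y.
-- The equation also gives X < T if Y ≥ T, hence Y < T in every case.  Then M ∣ X,
-- X < T, and the equation forces X = T − 1.  As M is even, T is odd, so
-- T = 1 and k + 1 = m.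

module Submission where

open import Defs
open import Data.Nat.Base using (ℕ; zero; suc; _+_; _*_; _^_; _∸_; _≤_; _<_; z≤n; s≤s; s≤s⁻¹; NonZero)
open import Data.Nat.Coprimality using (Coprime; coprime-divisor)
open import Data.Nat.Divisibility
open import Data.Nat.ListAction using (sum)
open import Data.Nat.ListAction.Properties using (sum-++; sum-↭)
open import Data.Nat.Primality using (Prime; ¬prime[1]; irreducible[2]; prime⇒irreducible; prime⇒nonZero; euclidsLemma)
open import Data.Nat.Properties
open import Data.Nat.Tactic.RingSolver using (solve-∀)
open import Data.List.Base using (List; []; _∷_; _++_; filter; map; upTo; applyUpTo; applyDownFrom)
open import Data.List.Properties using (filter-++)
open import Data.List.Membership.DecPropositional _≟_ using (_∈?_; _∉?_)
open import Data.List.Membership.Propositional using (_∈_)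
open import Data.List.Membership.Propositional.Properties
open import Data.List.Membership.Propositional.Properties.WithK using (unique∧set⇒bag)
open import Data.List.Relation.Binary.BagAndSetEquality using (∼bag⇒↭)
open import Data.List.Relation.Unary.All using (lookup)
open import Data.List.Relation.Unary.Unique.Propositional using (Unique)
import Data.List.Relation.Unary.Unique.Propositional.Properties as Unique
open import Data.Product.Base using (_×_; _,_; ∃-syntax; proj₁; proj₂)
open import Data.Sum.Base using (_⊎_; inj₁; inj₂)
open import Function.Base using (_∘_)
open import Function.Bundles using (_⇔_; mk⇔; Equivalence)
open import Relation.Binary.PropositionalEquality
open import Relation.Nullary.Decidable.Core using (Dec; yes; no; ¬?)
open import Relation.Nullary.Negation.Core using (¬_; contradiction)
open import Relation.Unary using (Decidable)

-- Two readings of one digit string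

-- The values of the first n digits, with d 0 least resp. most significant.
little big : (ℕ → ℕ) → ℕ → ℕ
little d zero    = 0
little d (suc n) = d n * 2 ^ n + little d n
big d zero    = 0
big d (suc n) = d 0 * 2 ^ n + big (d ∘ suc) n

-- The first `a` digits are the low block here and the high block in `big-+`. This opposition turns
-- divisibility of one value into a size bound on the other.
little-+ : ∀ d a b → little d (a + b) ≡ little (d ∘ (a +_)) b * 2 ^ a + little d a
little-+ d a zero    = cong (little d) (+-identityʳ a)
little-+ d a (suc b) = begin
  little d (a + suc b)
    ≡⟨ cong (little d) (+-suc a b) ⟩
  d (a + b) * 2 ^ (a + b) + little d (a + b)
    ≡⟨ cong₂ (λ u v → d (a + b) * u + v) (^-distribˡ-+-* 2 a b) (little-+ d a b) ⟩
  d (a + b) * (2 ^ a * 2 ^ b) + (l * 2 ^ a + little d a)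
    ≡⟨ regroup (d (a + b)) (2 ^ a) (2 ^ b) l (little d a) ⟩
  (d (a + b) * 2 ^ b + l) * 2 ^ a + little d a ∎
  where
  open ≡-Reasoning
  l = little (d ∘ (a +_)) b
  regroup : ∀ x A B l r → x * (A * B) + (l * A + r) ≡ (x * B + l) * A + r
  regroup = solve-∀

big-+ : ∀ d a b → big d (a + b) ≡ big d a * 2 ^ b + big (d ∘ (a +_)) b
big-+ d zero    b = refl
big-+ d (suc a) b = begin
  d 0 * 2 ^ (a + b) + big (d ∘ suc) (a + b)
    ≡⟨ cong₂ (λ u v → d 0 * u + v) (^-distribˡ-+-* 2 a b) (big-+ (d ∘ suc) a b) ⟩
  d 0 * (2 ^ a * 2 ^ b) + (big (d ∘ suc) a * 2 ^ b + r)
    ≡⟨ regroup (d 0) (2 ^ a) (2 ^ b) (big (d ∘ suc) a) r ⟩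
  (d 0 * 2 ^ a + big (d ∘ suc) a) * 2 ^ b + r ∎
  where
  open ≡-Reasoning
  r = big (d ∘ (suc a +_)) b
  regroup : ∀ x A B l r → x * (A * B) + (l * B + r) ≡ (x * A + l) * B + r
  regroup = solve-∀

big-cong : ∀ {d e} n → (∀ i → i < n → d i ≡ e i) → big d n ≡ big e n
big-cong zero    d≗e = refl
big-cong (suc n) d≗e =
  cong₂ (λ u v → u * 2 ^ n + v) (d≗e 0 (s≤s z≤n)) (big-cong n λ i i<n → d≗e (suc i) (s≤s i<n))

prepend-bit< : ∀ {b r} n → b ≤ 1 → r < 2 ^ n → b * 2 ^ n + r < 2 ^ suc n
prepend-bit< {b} {r} n b≤1 r<2ⁿ = begin-strict
  b * 2 ^ n + r     <⟨ +-mono-≤-< (*-monoˡ-≤ (2 ^ n) b≤1) r<2ⁿ ⟩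
  1 * 2 ^ n + 2 ^ n ≡⟨ +-comm (1 * 2 ^ n) (2 ^ n) ⟩
  2 ^ suc n         ∎
  where open ≤-Reasoning

little<2^ : ∀ {d} n → (∀ i → d i ≤ 1) → little d n < 2 ^ n
little<2^ zero    d≤1 = s≤s z≤n
little<2^ (suc n) d≤1 = prepend-bit< n (d≤1 n) (little<2^ n d≤1)

big<2^ : ∀ {d} n → (∀ i → d i ≤ 1) → big d n < 2 ^ n
big<2^ zero    d≤1 = s≤s z≤n
big<2^ (suc n) d≤1 = prepend-bit< n (d≤1 0) (big<2^ n (d≤1 ∘ suc))

leading-bit≡0 : ∀ b n {r} → b * 2 ^ n + r ≡ 0 → b ≡ 0
leading-bit≡0 b n eq = m*n≡0⇒m≡0 b (2 ^ n) {{m^n≢0 2 n}} (m+n≡0⇒m≡0 (b * 2 ^ n) eq)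

little≡0⇒digits≡0 : ∀ d n → little d n ≡ 0 → ∀ i → i < n → d i ≡ 0
little≡0⇒digits≡0 d (suc n) eq i i<1+n with m<1+n⇒m<n∨m≡n i<1+n
... | inj₁ i<n  = little≡0⇒digits≡0 d n (m+n≡0⇒n≡0 (d n * 2 ^ n) eq) i i<n
... | inj₂ refl = leading-bit≡0 (d n) n eq

big≡0⇒digits≡0 : ∀ d n → big d n ≡ 0 → ∀ i → i < n → d i ≡ 0
big≡0⇒digits≡0 d (suc n) eq zero    _   = leading-bit≡0 (d 0) n eq
big≡0⇒digits≡0 d (suc n) eq (suc i) i<n =
  big≡0⇒digits≡0 (d ∘ suc) n (m+n≡0⇒n≡0 (d 0 * 2 ^ n) eq) i (s≤s⁻¹ i<n)

digits≡0⇒little≡0 : ∀ d n → (∀ i → i < n → d i ≡ 0) → little d n ≡ 0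
digits≡0⇒little≡0 d zero    d≡0 = refl
digits≡0⇒little≡0 d (suc n) d≡0 rewrite d≡0 n ≤-refl =
  digits≡0⇒little≡0 d n (λ i i<n → d≡0 i (m<n⇒m<1+n i<n))

digits≡0⇒big≡0 : ∀ d n → (∀ i → i < n → d i ≡ 0) → big d n ≡ 0
digits≡0⇒big≡0 d zero    d≡0 = refl
digits≡0⇒big≡0 d (suc n) d≡0 rewrite d≡0 0 (s≤s z≤n) =
  digits≡0⇒big≡0 (d ∘ suc) n (λ i i<n → d≡0 (suc i) (s≤s i<n))

-- Either value vanishes exactly when every digit does. This fact and its converse carry information
-- between the two readings.
little≡0⇒big≡0 : ∀ d n → little d n ≡ 0 → big d n ≡ 0
little≡0⇒big≡0 d n eq = digits≡0⇒big≡0 d n (little≡0⇒digits≡0 d n eq)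

big≡0⇒little≡0 : ∀ d n → big d n ≡ 0 → little d n ≡ 0
big≡0⇒little≡0 d n eq = digits≡0⇒little≡0 d n (big≡0⇒digits≡0 d n eq)

-- Bit reversal: divisibility against size

n∣m*n+r⇒r≡0 : ∀ m {n r} → r < n → n ∣ m * n + r → r ≡ 0
n∣m*n+r⇒r≡0 m {r = zero}  _   _ = refl
n∣m*n+r⇒r≡0 m {r = suc _} r<n n∣ =
  contradiction (∣⇒≤ (∣m+n∣m⇒∣n n∣ (n∣m*n m))) (<⇒≱ r<n)

m*n+r<n⇒m≡0 : ∀ m {n r} → m * n + r < n → m ≡ 0
m*n+r<n⇒m≡0 zero        _ = refl
m*n+r<n⇒m≡0 (suc m) {n} lt =
  contradiction (≤-trans (m≤m+n n (m * n)) (m≤m+n _ _)) (<⇒≱ lt)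

module _ {d : ℕ → ℕ} (d≤1 : ∀ i → d i ≤ 1) {n} a b (n≡a+b : n ≡ a + b) where

  private
    tail : ℕ → ℕ
    tail = d ∘ (a +_)

    little-split : little d n ≡ little tail b * 2 ^ a + little d a
    little-split = trans (cong (little d) n≡a+b) (little-+ d a b)

    big-split : big d n ≡ big d a * 2 ^ b + big tail b
    big-split = trans (cong (big d) n≡a+b) (big-+ d a b)

  -- Divisibility clears the first `a` digits, the low block of `little`. They are the top digits of
  -- `big`, which is left with `b` digits.
  2^∣little⇒big< : 2 ^ a ∣ little d n → big d n < 2 ^ b
  2^∣little⇒big< div = subst (_< 2 ^ b) (sym eq) (big<2^ b (d≤1 ∘ (a +_)))
    where
    low≡0 : little d a ≡ 0
    low≡0 = n∣m*n+r⇒r≡0 (little tail b) (little<2^ a d≤1) (subst (2 ^ a ∣_) little-split div)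
    eq : big d n ≡ big tail b
    eq = trans big-split (cong (λ x → x * 2 ^ b + big tail b) (little≡0⇒big≡0 d a low≡0))

  -- The bound leaves no room for the top `a` digits of `big`, which are the lowest of `little`.
  big<⇒2^∣little : big d n < 2 ^ b → 2 ^ a ∣ little d n
  big<⇒2^∣little lt = subst (2 ^ a ∣_) (sym eq) (n∣m*n (little tail b))
    where
    high≡0 : big d a ≡ 0
    high≡0 = m*n+r<n⇒m≡0 (big d a) (subst (_< 2 ^ b) big-split lt)
    eq : little d n ≡ little tail b * 2 ^ a
    eq = trans little-split
           (trans (cong (little tail b * 2 ^ a +_) (big≡0⇒little≡0 d a high≡0)) (+-identityʳ _))

  -- The same exchange for the last `b` digits, lowest in `big` and highest in `little`.
  2^∣big⇒little< : 2 ^ b ∣ big d n → little d n < 2 ^ a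
  2^∣big⇒little< div = subst (_< 2 ^ a) (sym eq) (little<2^ a d≤1)
    where
    low≡0 : big tail b ≡ 0
    low≡0 = n∣m*n+r⇒r≡0 (big d a) (big<2^ b (d≤1 ∘ (a +_))) (subst (2 ^ b ∣_) big-split div)
    eq : little d n ≡ little d a
    eq = trans little-split (cong (λ x → x * 2 ^ a + little d a) (big≡0⇒little≡0 tail b low≡0))

  little<⇒2^∣big : little d n < 2 ^ a → 2 ^ b ∣ big d n
  little<⇒2^∣big lt = subst (2 ^ b ∣_) (sym eq) (n∣m*n (big d a))
    where
    high≡0 : little tail b ≡ 0
    high≡0 = m*n+r<n⇒m≡0 (little tail b) (subst (_< 2 ^ a) little-split lt)
    eq : big d n ≡ big d a * 2 ^ b
    eq = trans big-split
           (trans (cong (big d a * 2 ^ b +_) (little≡0⇒big≡0 tail b high≡0)) (+-identityʳ _))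

-- The equation modulo `suc p` and in size

module _ {p X Y T : ℕ} .{{_ : NonZero p}} (eq : Y + suc X * p + 1 ≡ suc p * T) where

  private
    -- Adding `X` completes `suc X * p + 1` to `suc X * suc p`, so `X` and `Y` are congruent modulo
    -- `suc p`.
    shifted : (X * suc p + suc p) + Y ≡ suc p * T + X
    shifted = trans (regroup p X Y) (cong (_+ X) eq)
      where
      regroup : ∀ p X Y → (X * suc p + suc p) + Y ≡ (Y + suc X * p + 1) + X
      regroup = solve-∀

    multiple : suc p ∣ X * suc p + suc p
    multiple = ∣m∣n⇒∣m+n (n∣m*n X) ∣-refl

  ∣X⇒∣Y : suc p ∣ X → suc p ∣ Y
  ∣X⇒∣Y p∣X = ∣m+n∣m⇒∣n (subst (suc p ∣_) (sym shifted) (∣m∣n⇒∣m+n (m∣m*n T) p∣X)) multiple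

  ∣Y⇒∣X : suc p ∣ Y → suc p ∣ X
  ∣Y⇒∣X p∣Y = ∣m+n∣m⇒∣n (subst (suc p ∣_) shifted (∣m∣n⇒∣m+n multiple p∣Y)) (m∣m*n T)

  -- If `Y` covers one of the `suc p` copies of `T`, the `p` copies of `suc X` fit into the other
  -- `p`.
  T≤Y⇒X<T : T ≤ Y → X < T
  T≤Y⇒X<T T≤Y = *-cancelʳ-≤ (suc X) T p (+-cancelˡ-≤ T _ _ (begin
    T + suc X * p     ≤⟨ +-monoˡ-≤ (suc X * p) T≤Y ⟩
    Y + suc X * p     ≤⟨ m≤m+n _ 1 ⟩
    Y + suc X * p + 1 ≡⟨ eq ⟩
    T + p * T         ≡⟨ cong (T +_) (*-comm p T) ⟩
    T + T * p         ∎))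
    where open ≤-Reasoning

  -- Even with the summand `1`, `Y` fills at most one copy of `T`, so the `p` copies of `suc X` must
  -- fill the other `p`.
  Y<T⇒T≤1+X : Y < T → T ≤ suc X
  Y<T⇒T≤1+X Y<T = *-cancelʳ-≤ T (suc X) p (+-cancelˡ-≤ T _ _ (begin
    T + T * p         ≡⟨ cong (T +_) (*-comm T p) ⟩
    T + p * T         ≡⟨ eq ⟨
    Y + suc X * p + 1 ≡⟨ +-comm _ 1 ⟩
    suc Y + suc X * p ≤⟨ +-monoˡ-≤ (suc X * p) Y<T ⟩
    T + suc X * p     ∎))
    where open ≤-Reasoning

-- Solving the bit-reversal equation

-- The left side contains a copy of `p` and the final `1`, so it is at least `suc p`. This permits
-- writing `K` as `m` plus a remainder.
exponent≤ : ∀ {d p} m K → suc p ≡ 2 ^ m → little d K + suc (big d K) * p + 1 ≡ 2 ^ K → m ≤ K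
exponent≤ {d} {p} m K 1+p≡2^m eq = ≮⇒≥ λ K<m → <⇒≱ (^-monoʳ-< 2 ≤-refl K<m) (begin
  2 ^ m                                ≡⟨ 1+p≡2^m ⟨
  suc p                                ≤⟨ s≤s (≤-trans (m≤m+n p _) (m≤n+m _ (little d K))) ⟩
  suc (little d K + suc (big d K) * p) ≡⟨ +-comm 1 _ ⟩
  little d K + suc (big d K) * p + 1   ≡⟨ eq ⟩
  2 ^ K                                ∎)
  where open ≤-Reasoning

bit-reversal-equation : ∀ {d p} → (∀ i → d i ≤ 1) → .{{NonZero p}} → ∀ m K → 1 ≤ m →
  suc p ≡ 2 ^ m → little d K + suc (big d K) * p + 1 ≡ 2 ^ K → K ≡ m
bit-reversal-equation {d} {p} d≤1 (suc m) K _ 1+p≡2^m eq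
  with m≤n⇒∃[o]m+o≡n (exponent≤ {d} {p} (suc m) K 1+p≡2^m eq)
... | zero  , refl = +-identityʳ (suc m)
-- With a positive remainder `T` is even, and so is `X` as a multiple of `suc p`, yet `suc X ≡ T`.
... | suc j , refl = contradiction (∣1⇒≡1 2∣1) λ ()
  where
  -- `M` is an exponent here; the modulus `suc p` is `2 ^ M`.
  M = suc m
  X = big d (M + suc j)
  Y = little d (M + suc j)
  T = 2 ^ suc j

  eq′ : Y + suc X * p + 1 ≡ suc p * T
  eq′ = trans eq (trans (^-distribˡ-+-* 2 M (suc j)) (cong (_* T) (sym 1+p≡2^m)))

  X<T⇒∣Y : X < T → suc p ∣ Y
  X<T⇒∣Y X<T = subst (_∣ Y) (sym 1+p≡2^m) (big<⇒2^∣little d≤1 M (suc j) refl X<T)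

  ∣Y⇒X<T : suc p ∣ Y → X < T
  ∣Y⇒X<T ∣Y = 2^∣little⇒big< d≤1 M (suc j) refl (subst (_∣ Y) 1+p≡2^m ∣Y)

  -- From here the digits are cut after `suc j` places instead of `M`.
  Y<T⇒∣X : Y < T → suc p ∣ X
  Y<T⇒∣X Y<T = subst (_∣ X) (sym 1+p≡2^m) (little<⇒2^∣big d≤1 (suc j) M (+-comm M (suc j)) Y<T)

  ∣X⇒Y<T : suc p ∣ X → Y < T
  ∣X⇒Y<T ∣X = 2^∣big⇒little< d≤1 (suc j) M (+-comm M (suc j)) (subst (_∣ X) 1+p≡2^m ∣X)

  -- If `T ≤ Y`, then `X < T`; bit reversal makes `suc p` divide `Y`, the congruence makes it divide
  -- `X`, and bit reversal returns `Y < T`.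
  Y<T : Y < T
  Y<T = ≰⇒> λ T≤Y →
    <⇒≱ (∣X⇒Y<T (∣Y⇒∣X {p} {X} {Y} {T} eq′ (X<T⇒∣Y (T≤Y⇒X<T {p} {X} {Y} {T} eq′ T≤Y)))) T≤Y

  p∣X : suc p ∣ X
  p∣X = Y<T⇒∣X Y<T

  1+X≡T : suc X ≡ T
  1+X≡T = ≤-antisym (∣Y⇒X<T (∣X⇒∣Y {p} {X} {Y} {T} eq′ p∣X)) (Y<T⇒T≤1+X {p} {X} {Y} {T} eq′ Y<T)

  2∣X : 2 ∣ X
  2∣X = ∣-trans (subst (2 ∣_) (sym 1+p≡2^m) (m∣m*n (2 ^ m))) p∣X

  2∣1 : 2 ∣ 1
  2∣1 = ∣m+n∣m⇒∣n (subst (2 ∣_) (trans (sym 1+X≡T) (+-comm 1 X)) (m∣m*n (2 ^ j))) 2∣X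

-- Sums over sublists as digit values

bit : ∀ {a} {A : Set a} → Dec A → ℕ
bit (yes _) = 1
bit (no  _) = 0

bit≤1 : ∀ {a} {A : Set a} (A? : Dec A) → bit A? ≤ 1
bit≤1 (yes _) = ≤-refl
bit≤1 (no  _) = z≤n

bit-cong : ∀ {a b} {A : Set a} {B : Set b} (A? : Dec A) (B? : Dec B) →
  (A → B) → (B → A) → bit A? ≡ bit B?
bit-cong (yes _) (yes _) _   _   = refl
bit-cong (no  _) (no  _) _   _   = refl
bit-cong (yes a) (no ¬b) A⇒B _   = contradiction (A⇒B a) ¬b
bit-cong (no ¬a) (yes b) _   B⇒A = contradiction (B⇒A b) ¬a

-- Duplicate-free lists with the same members are permutations of each other, so `S` and `divisors`
-- can be traded for explicit lists.
sum-cong-set : ∀ {xs ys} → Unique xs → Unique ys → (∀ {x} → x ∈ xs ⇔ x ∈ ys) → sum xs ≡ sum ys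
sum-cong-set xs! ys! xs≈ys = sum-↭ (∼bag⇒↭ (unique∧set⇒bag xs! ys! xs≈ys))

module _ {a} {P : ℕ → Set a} (P? : Decidable P) where

  sum-filter-∁ : ∀ xs → sum (filter P? xs) + sum (filter (¬? ∘ P?) xs) ≡ sum xs
  sum-filter-∁ []       = refl
  sum-filter-∁ (x ∷ xs) with P? x
  ... | yes _ = trans (+-assoc x _ _) (cong (x +_) (sum-filter-∁ xs))
  ... | no  _ = trans (regroup (sum (filter P? xs)) x _) (cong (x +_) (sum-filter-∁ xs))
    where
    regroup : ∀ u x v → u + (x + v) ≡ x + (u + v)
    regroup = solve-∀

  sum-filter-powers : ∀ n →
    sum (filter P? (applyDownFrom (2 ^_) n)) ≡ little (λ i → bit (P? (2 ^ i))) n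
  sum-filter-powers zero    = refl
  sum-filter-powers (suc n) with P? (2 ^ n)
  ... | yes _ = cong₂ _+_ (sym (+-identityʳ (2 ^ n))) (sum-filter-powers n)
  ... | no  _ = sum-filter-powers n

  -- Index `i` carries the cofactor of `2 ^ i`, so the largest multiple goes with digit `0`, the
  -- leading one in `big`. Removing it lowers `k`, as `suc k ∸ suc i` reduces to `k ∸ i`.
  sum-filter-multiples : ∀ k p →
    sum (filter P? (applyUpTo (λ i → 2 ^ (k ∸ i) * p) (suc k))) ≡
    big (λ i → bit (P? (2 ^ (k ∸ i) * p))) (suc k) * p
  sum-filter-multiples zero p with P? (1 * p)
  ... | yes _ = +-identityʳ (1 * p)
  ... | no  _ = refl
  sum-filter-multiples (suc k) p with P? (2 ^ suc k * p)
  ... | yes _ = begin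
    2 ^ suc k * p + sum (filter P? (applyUpTo (λ i → 2 ^ (k ∸ i) * p) (suc k)))
      ≡⟨ cong (2 ^ suc k * p +_) (sum-filter-multiples k p) ⟩
    2 ^ suc k * p + X * p
      ≡⟨ *-distribʳ-+ p (2 ^ suc k) X ⟨
    (2 ^ suc k + X) * p
      ≡⟨ cong (λ u → (u + X) * p) (*-identityˡ (2 ^ suc k)) ⟨
    (1 * 2 ^ suc k + X) * p ∎
    where
    open ≡-Reasoning
    X = big (λ i → bit (P? (2 ^ (k ∸ i) * p))) (suc k)
  ... | no  _ = sum-filter-multiples k p

-- Geometric sums

1+sum-powers : ∀ n → suc (sum (applyDownFrom (2 ^_) n)) ≡ 2 ^ n
1+sum-powers zero    = refl
1+sum-powers (suc n) = begin
  suc (2 ^ n + sum (applyDownFrom (2 ^_) n)) ≡⟨ +-suc (2 ^ n) _ ⟨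
  2 ^ n + suc (sum (applyDownFrom (2 ^_) n)) ≡⟨ cong (2 ^ n +_) (1+sum-powers n) ⟩
  2 ^ n + 2 ^ n                              ≡⟨ cong (2 ^ n +_) (+-identityʳ (2 ^ n)) ⟨
  2 ^ suc n                                  ∎
  where open ≡-Reasoning

sum-multiples+p : ∀ k p → sum (applyUpTo (λ i → 2 ^ (k ∸ i) * p) (suc k)) + p ≡ 2 ^ suc k * p
sum-multiples+p zero    p = regroup p
  where
  regroup : ∀ p → 1 * p + 0 + p ≡ 2 * p
  regroup = solve-∀
sum-multiples+p (suc k) p = begin
  2 ^ suc k * p + B + p             ≡⟨ +-assoc (2 ^ suc k * p) B p ⟩
  2 ^ suc k * p + (B + p)           ≡⟨ cong (2 ^ suc k * p +_) (sum-multiples+p k p) ⟩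
  2 ^ suc k * p + 2 ^ suc k * p     ≡⟨ regroup (2 ^ suc k) p ⟩
  2 ^ suc (suc k) * p               ∎
  where
  open ≡-Reasoning
  B = sum (applyUpTo (λ i → 2 ^ (k ∸ i) * p) (suc k))
  regroup : ∀ x p → x * p + x * p ≡ 2 * x * p
  regroup = solve-∀

-- The divisors of `2 ^ k * p`

∣2^*p⇒ : ∀ {p} → Prime p → ∀ k {d} → d ∣ 2 ^ k * p →
  ∃[ i ] (i ≤ k × (d ≡ 2 ^ i ⊎ d ≡ 2 ^ i * p))
∣2^*p⇒ {p} pr zero {d} d∣p with prime⇒irreducible pr (subst (d ∣_) (*-identityˡ p) d∣p)
... | inj₁ d≡1 = 0 , z≤n , inj₁ d≡1
... | inj₂ d≡p = 0 , z≤n , inj₂ (trans d≡p (sym (*-identityˡ p)))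
∣2^*p⇒ {p} pr (suc k) {d} d∣n with 2 ∣? d
... | no 2∤d =
  let i , i≤k , form = ∣2^*p⇒ pr k (coprime-divisor coprime (subst (d ∣_) (*-assoc 2 (2 ^ k) p) d∣n))
  in  i , m≤n⇒m≤1+n i≤k , form
  where
  coprime : Coprime d 2
  coprime (e∣d , e∣2) with irreducible[2] e∣2
  ... | inj₁ e≡1  = e≡1
  ... | inj₂ refl = contradiction e∣d 2∤d
... | yes (divides-refl q)
  with ∣2^*p⇒ pr k {q} (*-cancelˡ-∣ 2 (subst₂ _∣_ (*-comm q 2) (*-assoc 2 (2 ^ k) p) d∣n))
...   | i , i≤k , inj₁ refl = suc i , s≤s i≤k , inj₁ (*-comm (2 ^ i) 2)
...   | i , i≤k , inj₂ refl =
  suc i , s≤s i≤k , inj₂ (trans (*-comm (2 ^ i * p) 2) (sym (*-assoc 2 (2 ^ i) p)))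

prime∣2^⇒≡2 : ∀ {p} → Prime p → ∀ i → p ∣ 2 ^ i → p ≡ 2
prime∣2^⇒≡2 pr zero    p∣1 with refl ← ∣1⇒≡1 p∣1 = contradiction pr ¬prime[1]
prime∣2^⇒≡2 pr (suc i) p∣2^ with euclidsLemma 2 (2 ^ i) pr p∣2^
... | inj₂ p∣2^i = prime∣2^⇒≡2 pr i p∣2^i
... | inj₁ p∣2 with irreducible[2] p∣2
...   | inj₁ refl = contradiction pr ¬prime[1]
...   | inj₂ p≡2  = p≡2

2^-factorisation : ∀ {i k} p → i ≤ k → 2 ^ k * p ≡ 2 ^ (k ∸ i) * p * 2 ^ i
2^-factorisation {i} {k} p i≤k = begin
  2 ^ k * p                   ≡⟨ cong (λ e → 2 ^ e * p) (m∸n+n≡m i≤k) ⟨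
  2 ^ (k ∸ i + i) * p         ≡⟨ cong (_* p) (^-distribˡ-+-* 2 (k ∸ i) i) ⟩
  2 ^ (k ∸ i) * 2 ^ i * p     ≡⟨ regroup (2 ^ (k ∸ i)) (2 ^ i) p ⟩
  2 ^ (k ∸ i) * p * 2 ^ i     ∎
  where
  open ≡-Reasoning
  regroup : ∀ x y p → x * y * p ≡ x * p * y
  regroup = solve-∀

powers multiples divisorList : ℕ → ℕ → List ℕ
powers k p      = applyDownFrom (2 ^_) (suc k)
multiples k p   = applyUpTo (λ i → 2 ^ (k ∸ i) * p) (suc k)
divisorList k p = powers k p ++ multiples k p

module _ {p : ℕ} (pr : Prime p) (k : ℕ) where

  private instance
    p≢0 : NonZero p
    p≢0 = prime⇒nonZero pr

  ∈-divisorList : ∀ {d} → d ∈ divisorList k p ⇔ d ∣ 2 ^ k * p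
  ∈-divisorList {d} = mk⇔ to from
    where
    to : d ∈ divisorList k p → d ∣ 2 ^ k * p
    to d∈ with ∈-++⁻ (powers k p) d∈
    ... | inj₁ d∈powers with i , i≤k , refl ← ∈-applyDownFrom⁻ (2 ^_) d∈powers =
      divides (2 ^ (k ∸ i) * p) (2^-factorisation p (s≤s⁻¹ i≤k))
    ... | inj₂ d∈multiples with i , i≤k , refl ← ∈-applyUpTo⁻ (λ i → 2 ^ (k ∸ i) * p) d∈multiples =
      divides (2 ^ i) (trans (2^-factorisation p (s≤s⁻¹ i≤k)) (*-comm _ (2 ^ i)))
    from : d ∣ 2 ^ k * p → d ∈ divisorList k p
    from d∣n with ∣2^*p⇒ pr k d∣n
    ... | i , i≤k , inj₁ refl = ∈-++⁺ˡ (∈-applyDownFrom⁺ (2 ^_) (s≤s i≤k))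
    -- The multiple `2 ^ i * p` stands at index `k ∸ i`.
    ... | i , i≤k , inj₂ refl = ∈-++⁺ʳ (powers k p)
      (subst (λ e → 2 ^ e * p ∈ multiples k p) (m∸[m∸n]≡n i≤k)
        (∈-applyUpTo⁺ (λ i → 2 ^ (k ∸ i) * p) (s≤s (m∸n≤m k i))))

  divisorList-unique : ¬ 2 ∣ p → Unique (divisorList k p)
  divisorList-unique 2∤p = Unique.++⁺
    (Unique.applyDownFrom⁺₁ (2 ^_) (suc k) λ j<i _ → >⇒≢ (^-monoʳ-< 2 ≤-refl j<i))
    (Unique.applyUpTo⁺₁ (λ i → 2 ^ (k ∸ i) * p) (suc k) λ i<j j≤k →
      >⇒≢ (*-monoˡ-< p (^-monoʳ-< 2 ≤-refl (∸-monoʳ-< i<j (s≤s⁻¹ j≤k)))))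
    disjoint
    where
    -- A common entry would make the prime `p` divide a power of two, forcing `p ≡ 2`.
    disjoint : ∀ {d} → ¬ (d ∈ powers k p × d ∈ multiples k p)
    disjoint (d∈powers , d∈multiples)
      with i , _ , refl ← ∈-applyDownFrom⁻ (2 ^_) d∈powers
      with j , _ , eq ← ∈-applyUpTo⁻ (λ i → 2 ^ (k ∸ i) * p) d∈multiples
      with refl ← prime∣2^⇒≡2 pr i (divides (2 ^ (k ∸ j)) eq) = 2∤p ∣-refl

  -- This is the product formula `(2 ^ (k + 1) - 1) * (p + 1)` for the divisor sum, with the
  -- subtraction cleared.
  sum-divisorList : sum (divisorList k p) + suc p ≡ 2 ^ suc k + 2 ^ suc k * p
  sum-divisorList = begin
    sum (divisorList k p) + suc p     ≡⟨ cong (_+ suc p) (sum-++ (powers k p) (multiples k p)) ⟩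
    A + B + suc p                     ≡⟨ regroup A B p ⟩
    suc A + (B + p)                   ≡⟨ cong₂ _+_ (1+sum-powers (suc k)) (sum-multiples+p k p) ⟩
    2 ^ suc k + 2 ^ suc k * p         ∎
    where
    open ≡-Reasoning
    A = sum (powers k p)
    B = sum (multiples k p)
    regroup : ∀ A B p → A + B + suc p ≡ suc A + (B + p)
    regroup = solve-∀

-- From `divisors` to the theorem

∈-divisors : ∀ n {d} → .{{NonZero n}} → d ∈ divisors n ⇔ d ∣ n
∈-divisors n@(suc _) {d} = mk⇔ (proj₂ ∘ ∈-filter⁻ (_∣? n) {xs = map suc (upTo n)}) from
  where
  from : ∀ {d} → d ∣ n → d ∈ divisors n
  from {zero}  0∣n = contradiction (0∣⇒≡0 0∣n) λ ()
  from {suc d} d∣n = ∈-filter⁺ (_∣? n) (∈-map⁺ suc (∈-upTo⁺ (∣⇒≤ d∣n))) d∣n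

divisors-unique : ∀ n → Unique (divisors n)
divisors-unique n = Unique.filter⁺ (_∣? n) (Unique.map⁺ suc-injective (Unique.upTo⁺ n))

theorem6 : (n k p m : ℕ) → StronglyPseudoperfect n → n ≡ 2 ^ k * p → 1 ≤ m → p ≡ 2 ^ m ∸ 1 → Prime p → Perfect n
theorem6 n k p m@(suc m-1) (n≢0 , S , S! , S∣n , S-sym , ΣS≡2n) refl 1≤m p≡2^m∸1 pr = n≢0 , σn≡2n
  where
  open ≡-Reasoning
  instance
    _ = n≢0
    _ = prime⇒nonZero pr

  1+p≡2^m : suc p ≡ 2 ^ m
  1+p≡2^m = trans (cong suc p≡2^m∸1) (m+[n∸m]≡n (m^n>0 2 m))

  2∤p : ¬ 2 ∣ p
  2∤p 2∣p = contradiction (∣1⇒≡1 (∣m+n∣m⇒∣n {m = p} (subst (2 ∣_) (trans (sym 1+p≡2^m) (+-comm 1 p)) (m∣m*n (2 ^ m-1))) 2∣p)) λ ()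

  D : List ℕ
  D = divisorList k p

  D! : Unique D
  D! = divisorList-unique pr k 2∤p

  module D {d} = Equivalence (∈-divisorList pr k {d})

  -- Rewriting `S` as a sublist of `D` makes the sum of the missing divisors available as the
  -- complementary sublist.
  sumS : sum S ≡ sum (filter (_∈? S) D)
  sumS = sum-cong-set S! (Unique.filter⁺ (_∈? S) D!) (mk⇔
    (λ x∈S → ∈-filter⁺ (_∈? S) (D.from (lookup S∣n x∈S)) x∈S)
    (proj₂ ∘ ∈-filter⁻ (_∈? S) {xs = D}))

  d : ℕ → ℕ
  d i = bit (2 ^ i ∉? S)

  X Y : ℕ
  X = big d (suc k)
  Y = little d (suc k)

  -- The symmetry of `S` enters here: the `quotient` of the given divisibility proof reduces to
  -- `2 ^ (k ∸ i) * p`, so both cofactors share one digit.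
  d-cofactor : ∀ i → i < suc k → bit (2 ^ (k ∸ i) * p ∉? S) ≡ d i
  d-cofactor i i≤k = bit-cong (_ ∉? S) (_ ∉? S) (_∘ S⇔.to) (_∘ S⇔.from)
    where
    module S⇔ = Equivalence (S-sym (divides (2 ^ (k ∸ i) * p) (2^-factorisation p (s≤s⁻¹ i≤k))))

  sum∉S : sum (filter (_∉? S) D) ≡ Y + X * p
  sum∉S = begin
    sum (filter (_∉? S) D)
      ≡⟨ cong sum (filter-++ (_∉? S) (powers k p) (multiples k p)) ⟩
    sum (filter (_∉? S) (powers k p) ++ filter (_∉? S) (multiples k p))
      ≡⟨ sum-++ (filter (_∉? S) (powers k p)) _ ⟩
    sum (filter (_∉? S) (powers k p)) + sum (filter (_∉? S) (multiples k p))
      ≡⟨ cong₂ _+_ (sum-filter-powers (_∉? S) (suc k)) (sum-filter-multiples (_∉? S) k p) ⟩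
    Y + big (λ i → bit (2 ^ (k ∸ i) * p ∉? S)) (suc k) * p
      ≡⟨ cong (λ u → Y + u * p) (big-cong (suc k) d-cofactor) ⟩
    Y + X * p ∎

  2n+sum∉S : 2 ^ suc k * p + (Y + X * p) ≡ sum D
  2n+sum∉S = begin
    2 ^ suc k * p + (Y + X * p)
      ≡⟨ cong₂ _+_ (trans (*-assoc 2 (2 ^ k) p) (trans (sym ΣS≡2n) sumS)) (sym sum∉S) ⟩
    sum (filter (_∈? S) D) + sum (filter (_∉? S) D)
      ≡⟨ sum-filter-∁ (_∈? S) D ⟩
    sum D ∎

  -- After cancelling `2n`, the `suc p` from `sum-divisorList` supplies the extra copy of `p` in
  -- `suc X * p` and the final `1`.
  digit-equation : Y + suc X * p + 1 ≡ 2 ^ suc k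
  digit-equation = +-cancelʳ-≡ (2 ^ suc k * p) _ _ (begin
    Y + suc X * p + 1 + 2 ^ suc k * p     ≡⟨ regroup X Y p (2 ^ suc k * p) ⟩
    2 ^ suc k * p + (Y + X * p) + suc p   ≡⟨ cong (_+ suc p) 2n+sum∉S ⟩
    sum D + suc p                         ≡⟨ sum-divisorList pr k ⟩
    2 ^ suc k + 2 ^ suc k * p             ∎)
    where
    regroup : ∀ X Y p Z → Y + suc X * p + 1 + Z ≡ Z + (Y + X * p) + suc p
    regroup = solve-∀

  1+k≡m : suc k ≡ m
  1+k≡m = bit-reversal-equation {d} (λ i → bit≤1 (2 ^ i ∉? S)) m (suc k) 1≤m 1+p≡2^m digit-equation

  -- Euclid's computation: `2 ^ suc k` is now `suc p`, the very term added to the divisor sum, and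
  -- `2n` remains.
  σn≡2n : σ (2 ^ k * p) ≡ 2 * (2 ^ k * p)
  σn≡2n = +-cancelʳ-≡ (suc p) _ _ (begin
    σ (2 ^ k * p) + suc p
      ≡⟨ cong (_+ suc p) (sum-cong-set (divisors-unique (2 ^ k * p)) D! (mk⇔
           (D.from ∘ Equivalence.to (∈-divisors (2 ^ k * p))) (Equivalence.from (∈-divisors (2 ^ k * p)) ∘ D.to))) ⟩
    sum D + suc p
      ≡⟨ sum-divisorList pr k ⟩
    2 ^ suc k + 2 ^ suc k * p
      ≡⟨ cong₂ _+_ (trans (cong (2 ^_) 1+k≡m) (sym 1+p≡2^m)) (*-assoc 2 (2 ^ k) p) ⟩
    suc p + 2 * (2 ^ k * p)
      ≡⟨ +-comm (suc p) _ ⟩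
    2 * (2 ^ k * p) + suc p ∎)
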